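{- Let $S$ be a connected cluster-acyclic quiver of order $3$. Then: 1) the mutation class of $S$ contains a unique (up to change of orientations of edges) quiver $S_0$ without oriented cycle; 2) the total weight of $S_0$ is minimal amongst all quivers of the mutation class of $S$; 3) any sequence of mutations applied to $S$ which decreases the total weight at each step, and which cannot be prolonged by a further mutation decreasing the total weight, ends in $S_0$ (up to change of orientations of edges).
   Context: A quiver is a finite directed multigraph without loops and oriented $2$-cycles; parallel arrows are recorded as one edge with a positive integer weight. A quiver with vertices $1,\dots,n$ is the same as a skew-symmetric integer $n\times n$ matrix $B$: if $B_{ij}>0$ there is an edge $i\to j$ of weight $B_{ij}$. The order of a quiver is its number of vertices. The mutation in direction $k$ sends $B$ to $B'$ with $B'_{ij}=-B_{ij}$ if $i=k$ or $j=k$, and $B'_{ij}=B_{ij}+\frac{|B_{ik}|B_{kj}+B_{ik}|B_{kj}|}{2}$ otherwise. The mutation class of a quiver is the set of all quivers obtained from it by finite sequences of mutations; here quivers are considered up to isomorphism (relabeling of vertices). A quiver of order $3$ is cyclic if it is an oriented cycle (all three edges are present and form an oriented triangle), and acyclic otherwise. It is cluster-cyclic if every quiver mutation-equivalent to it is cyclic, and cluster-acyclic otherwise. The total weight of a quiver is the sum of the weights of its edges. "Up to change of orientations of edges" means: up to isomorphism of the underlying weighted unoriented graphs (among acyclic quivers). -}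

module Defs where

open import Data.Bool.Base using (true; false; _∨_; if_then_else_)
open import Data.Fin.Base using (Fin)
open import Data.Fin.Permutation using (Permutation′; _⟨$⟩ʳ_)
open import Data.Fin.Properties using (_≟_)
open import Data.Integer.Base as ℤ
  using (ℤ; +_; -[1+_]; 0ℤ; ∣_∣; _+_; _*_; -_; _⊔_; _/ℕ_)
open import Data.Integer.DivMod using ([n/ℕd]*d≤n; n<s[n/ℕd]*d)
import Data.Integer.Properties as ℤₚ
open import Data.List.Base using (List; []; _∷_; foldl)
open import Data.Nat.Base as ℕ using (ℕ)
import Data.Nat.Properties as ℕₚ
open import Algebra.Properties.Monoid.Sum ℕₚ.+-0-monoid using (sum)
open import Data.Product.Base using (Σ-syntax; ∃-syntax; _×_; _,_)
open import Data.Unit.Base using (⊤)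
open import Relation.Binary.Construct.Closure.Equivalence using (EqClosure)
open import Relation.Binary.PropositionalEquality
open import Relation.Nullary using (¬_; does)

Matrix : ℕ → Set
Matrix n = Fin n → Fin n → ℤ

-- Skew-symmetry over ℤ forces a zero diagonal (no loops), and an entry has only
-- one sign (no oriented 2-cycles).
record Quiver (n : ℕ) : Set where
  constructor quiver
  field
    B    : Matrix n
    skew : ∀ i j → B i j ≡ - B j i

open Quiver public

numerator : ℤ → ℤ → ℤ
numerator a b = + ∣ a ∣ * b + a * + ∣ b ∣

-- The numerator is always even (numerator-even), so the floor division /ℕ is exact.
mutateMatrix : ∀ {n} → Fin n → Matrix n → Matrix n
mutateMatrix k b i j =
  if does (i ≟ k) ∨ does (j ≟ k)
  then - b i j
  else b i j + numerator (b i k) (b k j) /ℕ 2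

numerator-even : ∀ a b → ∃[ m ] (numerator a b ≡ m * + 2)
numerator-even a b = let m , e = go a b in m , trans e (dbl m)
  where
  dbl : ∀ m → m + m ≡ m * + 2
  dbl m = sym (trans (ℤₚ.*-distribˡ-+ m (+ 1) (+ 1))
                     (cong₂ _+_ (ℤₚ.*-identityʳ m) (ℤₚ.*-identityʳ m)))
  go : ∀ a b → ∃[ m ] (numerator a b ≡ m + m)
  go (+ p) (+ q) = + p * + q , refl
  go (+ p) b@(-[1+ q ]) = 0ℤ ,
    trans (cong (λ x → + p * b + x) (sym (ℤₚ.neg-distribʳ-* (+ p) b))) (ℤₚ.+-inverseʳ (+ p * b))
  go a@(-[1+ p ]) (+ q) = 0ℤ ,
    trans (cong (λ x → x + a * + q) (sym (ℤₚ.neg-distribˡ-* a (+ q)))) (ℤₚ.+-inverseˡ (a * + q))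
  go a@(-[1+ p ]) b@(-[1+ q ]) = - (a * b) ,
    cong₂ _+_ (sym (ℤₚ.neg-distribˡ-* a b)) (sym (ℤₚ.neg-distribʳ-* a b))

half-double : ∀ m → (m * + 2) /ℕ 2 ≡ m
half-double m = ℤₚ.≤-antisym
  (ℤₚ.*-cancelʳ-≤-pos _ _ (+ 2) ([n/ℕd]*d≤n (m * + 2) 2))
  (subst (m ℤ.≤_) (ℤₚ.pred-suc q)
    (ℤₚ.i<j⇒i≤pred[j] {m} {ℤ.suc q} (ℤₚ.*-cancelʳ-<-nonNeg (+ 2) (n<s[n/ℕd]*d (m * + 2) 2))))
  where q = (m * + 2) /ℕ 2

half-numerator-skew : ∀ {n} (b : Matrix n) → (∀ i j → b i j ≡ - b j i) → ∀ i j k →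
                      numerator (b i k) (b k j) /ℕ 2 ≡ - (numerator (b j k) (b k i) /ℕ 2)
half-numerator-skew b sk i j k with numerator-even (b j k) (b k i)
... | m , e = begin
  numerator (b i k) (b k j) /ℕ 2      ≡⟨ cong (_/ℕ 2) swap ⟩
  (- numerator (b j k) (b k i)) /ℕ 2  ≡⟨ cong (λ x → (- x) /ℕ 2) e ⟩
  (- (m * + 2)) /ℕ 2                  ≡⟨ cong (_/ℕ 2) (ℤₚ.neg-distribˡ-* m (+ 2)) ⟩
  (- m * + 2) /ℕ 2                    ≡⟨ half-double (- m) ⟩
  - m                                 ≡⟨ cong -_ (half-double m) ⟨
  - ((m * + 2) /ℕ 2)                  ≡⟨ cong (λ x → - (x /ℕ 2)) e ⟨
  - (numerator (b j k) (b k i) /ℕ 2)  ∎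
  where
  open ≡-Reasoning
  swap : numerator (b i k) (b k j) ≡ - numerator (b j k) (b k i)
  swap = begin
    numerator (b i k) (b k j)
      ≡⟨ cong₂ numerator (sk i k) (sk k j) ⟩
    numerator (- b k i) (- b j k)
      ≡⟨ cong₂ (λ p q → + p * - b j k + - b k i * + q)
               (ℤₚ.∣-i∣≡∣i∣ (b k i)) (ℤₚ.∣-i∣≡∣i∣ (b j k)) ⟩
    + ∣ b k i ∣ * - b j k + - b k i * + ∣ b j k ∣
      ≡⟨ cong₂ _+_ (sym (ℤₚ.neg-distribʳ-* (+ ∣ b k i ∣) (b j k)))
                   (sym (ℤₚ.neg-distribˡ-* (b k i) (+ ∣ b j k ∣))) ⟩
    - (+ ∣ b k i ∣ * b j k) + - (b k i * + ∣ b j k ∣)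
      ≡⟨ ℤₚ.neg-distrib-+ (+ ∣ b k i ∣ * b j k) (b k i * + ∣ b j k ∣) ⟨
    - (+ ∣ b k i ∣ * b j k + b k i * + ∣ b j k ∣)
      ≡⟨ cong -_ (cong₂ _+_ (ℤₚ.*-comm (+ ∣ b k i ∣) (b j k))
                            (ℤₚ.*-comm (b k i) (+ ∣ b j k ∣))) ⟩
    - (b j k * + ∣ b k i ∣ + + ∣ b j k ∣ * b k i)
      ≡⟨ cong -_ (ℤₚ.+-comm (b j k * + ∣ b k i ∣) (+ ∣ b j k ∣ * b k i)) ⟩
    - numerator (b j k) (b k i) ∎

mutate-skew : ∀ {n} (k : Fin n) (b : Matrix n) → (∀ i j → b i j ≡ - b j i) →
              ∀ i j → mutateMatrix k b i j ≡ - mutateMatrix k b j i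
mutate-skew k b sk i j with does (i ≟ k) | does (j ≟ k)
... | true  | true  = cong -_ (sk i j)
... | true  | false = cong -_ (sk i j)
... | false | true  = cong -_ (sk i j)
... | false | false = trans
  (cong₂ _+_ (sk i j) (half-numerator-skew b sk i j k))
  (sym (ℤₚ.neg-distrib-+ (b j i) (numerator (b j k) (b k i) /ℕ 2)))

mutate : ∀ {n} → Fin n → Quiver n → Quiver n
mutate k Q = quiver (mutateMatrix k (B Q)) (mutate-skew k (B Q) (skew Q))

mutateAlong : ∀ {n} → List (Fin n) → Quiver n → Quiver n
mutateAlong ks Q = foldl (λ Q′ k → mutate k Q′) Q ks

infix 4 _≅_ _≅ᵘ_ _∈MutationClass_

_≅_ : ∀ {n} → Quiver n → Quiver n → Set
_≅_ {n} Q R = Σ[ σ ∈ Permutation′ n ] ∀ i j → B Q i j ≡ B R (σ ⟨$⟩ʳ i) (σ ⟨$⟩ʳ j)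

-- Isomorphism of the underlying weighted unoriented graphs.
_≅ᵘ_ : ∀ {n} → Quiver n → Quiver n → Set
_≅ᵘ_ {n} Q R =
  Σ[ σ ∈ Permutation′ n ] ∀ i j → ∣ B Q i j ∣ ≡ ∣ B R (σ ⟨$⟩ʳ i) (σ ⟨$⟩ʳ j) ∣

_∈MutationClass_ : ∀ {n} → Quiver n → Quiver n → Set
Q ∈MutationClass S = ∃[ ks ] (mutateAlong ks S ≅ Q)

Edge : ∀ {n} → Quiver n → Fin n → Fin n → Set
Edge Q i j = 0ℤ ℤ.< B Q i j

Connected : ∀ {n} → Quiver n → Set
Connected Q = ∀ i j → EqClosure (Edge Q) i j

-- The three vertices are automatically distinct, as there are no loops or 2-cycles.
Cyclic : Quiver 3 → Set
Cyclic Q = ∃[ i ] ∃[ j ] ∃[ k ] (Edge Q i j × Edge Q j k × Edge Q k i)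

Acyclic : Quiver 3 → Set
Acyclic Q = ¬ Cyclic Q

ClusterCyclic : Quiver 3 → Set
ClusterCyclic S = ∀ Q → Q ∈MutationClass S → Cyclic Q

ClusterAcyclic : Quiver 3 → Set
ClusterAcyclic S = ¬ ClusterCyclic S

-- Each edge i → j contributes at (i , j) only; the entry at (j , i) is negative.
totalWeight : ∀ {n} → Quiver n → ℕ
totalWeight Q = sum λ i → sum λ j → ∣ 0ℤ ⊔ B Q i j ∣

Decreases : ∀ {n} → Quiver n → Fin n → Set
Decreases Q k = totalWeight (mutate k Q) ℕ.< totalWeight Q

DecreasingSequence : ∀ {n} → Quiver n → List (Fin n) → Set
DecreasingSequence Q []       = ⊤
DecreasingSequence Q (k ∷ ks) = Decreases Q k × DecreasingSequence (mutate k Q) ks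

MaximalDecreasingSequence : ∀ {n} → Quiver n → List (Fin n) → Set
MaximalDecreasingSequence Q ks =
  DecreasingSequence Q ks × (∀ k → ¬ Decreases (mutateAlong ks Q) k)

{-# OPTIONS --safe #-}
-- Mutating an oriented triangle with weights a, b, c replaces c by |a b − c|. If no mutation
-- lowers the weight then 2c ≤ ab and likewise for a and b; every later mutation away from
-- the start then produces the new largest weight, so the class consists of oriented
-- triangles only. Hence descent in a cluster-acyclic class ends in an acyclic quiver.
-- For uniqueness, fix a property E of weight triples, and let E-trees be the triangles whose
-- descent at the largest weight ends with weights in E or gets stuck. They are closed under
-- mutation: when c is largest and b ≥ 2, replacing a by bc − a makes it the new largest
-- weight, and b = 1 can only occur one step from an acyclic quiver. Taking for E the weights
-- of one acyclic quiver shows that all acyclic members have these weights; E = ⊥ gives the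
-- cluster-cyclic case.
module Submission where

open import Defs
open import Data.Nat.Base using (_≤_)
open import Data.Product using (∃!; _×_)
open import Data.Empty using (⊥)
open import Data.Fin.Base using (Fin)
open import Data.Fin.Patterns using (0F; 1F; 2F)
open import Data.Fin.Permutation as Permutation
  using (_⟨$⟩ʳ_; _⟨$⟩ˡ_; _∘ₚ_; flip; inverseʳ; inverseˡ)
open import Data.Fin.Properties using (any?; _≟_)
open import Data.Integer.Base as ℤ
  using (ℤ; +_; -[1+_]; +[1+_]; +0; 0ℤ; ∣_∣; -_; _⊖_; +<+; _/ℕ_)
import Data.Integer.Properties as ℤₚ
open import Data.List.Base using (List; []; _∷_; _++_; lookup)
open import Data.List.Properties using (foldl-++)
open import Data.List.Relation.Binary.Permutation.Propositional as Perm
  using (_↭_; ↭-refl; ↭-trans; ↭⇒↭ₛ)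
open import Data.List.Relation.Binary.Permutation.Homogeneous using (onIndices)
open import Data.List.Relation.Binary.Permutation.Setoid.Properties using (onIndices-lookup)
open import Data.Nat.Base using (ℕ; zero; suc; _+_; _*_; _<_; z≤n; s≤s)
open import Data.Nat.Induction using (Acc; acc; <-wellFounded)
open import Data.Nat.ListAction using (sum)
open import Data.Nat.ListAction.Properties using (sum-↭)
open import Data.Nat.Properties hiding (_≟_)
open import Algebra.Properties.CommutativeMonoid.Sum +-0-commutativeMonoid
  using (sum-permute; sum-cong-≗) renaming (sum to ∑)
open import Data.Nat.Tactic.RingSolver using (solve-∀)
open import Data.Product.Base using (∃-syntax; _,_; proj₁; proj₂)
open import Data.Sum.Base using (_⊎_; inj₁; inj₂; [_,_]′)
open import Function.Base using (_∘_)
open import Relation.Binary.PropositionalEquality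
open import Relation.Nullary using (¬_; Dec; yes; no; contradiction)
open import Relation.Nullary.Decidable using (_×-dec_)

-- Arithmetic of the mutation rule.

-- Unlike the floor division, this reduces by signs alone: to a b if both arguments are nonnegative,
-- to -a b if both are negative, and to 0 otherwise.
half : ℤ → ℤ → ℤ
half a b = proj₁ (numerator-even a b)

numerator/2 : ∀ a b → numerator a b /ℕ 2 ≡ half a b
numerator/2 a b = trans (cong (_/ℕ 2) (proj₂ (numerator-even a b))) (half-double (half a b))

half-neg : ∀ a b → half (- a) (- b) ≡ - half a b
half-neg +0       +0       = refl
half-neg +0       +[1+ b ] = refl
half-neg +0       -[1+ b ] = refl
half-neg +[1+ a ] +0       = cong -_ (sym (ℤₚ.*-zeroʳ +[1+ a ]))
half-neg +[1+ a ] +[1+ b ] = refl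
half-neg +[1+ a ] -[1+ b ] = refl
half-neg -[1+ a ] +0       = ℤₚ.*-zeroʳ +[1+ a ]
half-neg -[1+ a ] +[1+ b ] = refl
half-neg -[1+ a ] -[1+ b ] = sym (ℤₚ.neg-involutive (+[1+ a ] ℤ.* +[1+ b ]))

m⊖[m+n]≡-n : ∀ m n → m ⊖ (m + n) ≡ - + n
m⊖[m+n]≡-n m n = trans (ℤₚ.⊖-≤ (m≤m+n m n)) (cong (-_ ∘ +_) (m+n∸m≡n m n))

[m+n]⊖m≡n : ∀ m n → (m + n) ⊖ m ≡ + n
[m+n]⊖m≡n m n = trans (ℤₚ.⊖-≥ (m≤m+n m n)) (cong +_ (m+n∸m≡n m n))

double≤* : ∀ {b c} → 1 < b → c + c ≤ b * c
double≤* {b} {c} 1<b = subst (_≤ b * c) (cong (λ z → c + z) (+-identityʳ c)) (*-monoˡ-≤ c 1<b)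

-- Excludes the acyclic outcome of a mutation: c = a b + d cannot hold once 2c ≤ a b.
no-overshoot : ∀ {m n d} → 1 ≤ m → m + m ≤ n → m ≢ n + d
no-overshoot {m} {n} {d} 1≤m 2m≤n refl = <-irrefl refl
  (<-≤-trans (m<m+n m 1≤m) (≤-trans 2m≤n (m≤m+n n d)))

factorsPositive : ∀ {a b c} → 1 ≤ c → c ≤ a * b → 1 ≤ a × 1 ≤ b
factorsPositive {zero} 1≤c c≤ab = contradiction (≤-trans 1≤c c≤ab) λ ()
factorsPositive {suc a} {zero} 1≤c c≤ab =
  contradiction (subst (1 ≤_) (*-zeroʳ a) (≤-trans 1≤c c≤ab)) λ ()
factorsPositive {suc a} {suc b} _ _ = s≤s z≤n , s≤s z≤n

Stuck : ℕ → ℕ → ℕ → Set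
Stuck a b c = a + a ≤ b * c × b + b ≤ c * a × c + c ≤ a * b

-- For b ≤ 1 the inequalities 2a ≤ b c and 2c ≤ a b would give 2a ≤ c and 2c ≤ a.
stuck>1 : ∀ {a b c} → 1 ≤ a → 1 ≤ c → Stuck a b c → 1 < b
stuck>1 {a} {b} {c} 1≤a 1≤c (p , q , r) = ≰⇒> λ b≤1 → <-irrefl refl (begin-strict
  a      <⟨ m<m+n a 1≤a ⟩
  a + a  ≤⟨ p ⟩
  b * c  ≤⟨ *-monoˡ-≤ c b≤1 ⟩
  1 * c  ≡⟨ *-identityˡ c ⟩
  c      ≤⟨ m≤m+n c c ⟩
  c + c  ≤⟨ r ⟩
  a * b  ≤⟨ *-monoʳ-≤ a b≤1 ⟩
  a * 1  ≡⟨ *-identityʳ a ⟩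
  a      ∎)
  where open ≤-Reasoning

-- a + c is at most twice the larger of the two. The bound makes a b - c at least a, so that a
-- mutated weight dominates.
+≤* : ∀ {a b c} → 1 < b → c + c ≤ a * b → a + c ≤ a * b
+≤* {a} {b} {c} 1<b 2c≤ab with ≤-total a c
... | inj₁ a≤c = ≤-trans (+-monoˡ-≤ c a≤c) 2c≤ab
... | inj₂ c≤a = ≤-trans (+-monoʳ-≤ a c≤a) (subst (a + a ≤_) (*-comm b a) (double≤* 1<b))

-- Signed triples of a three-vertex quiver.

-n≯0 : ∀ n → ¬ 0ℤ ℤ.< - + n
-n≯0 zero    (+<+ ())
-n≯0 (suc n) ()

-- A 3-vertex quiver is encoded as (B₁₂ , B₂₀ , B₀₁), where the k-th entry is the edge opposite to k.
Oriented : ℤ → ℤ → ℤ → Set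
Oriented p q r = 0ℤ ℤ.< p × 0ℤ ℤ.< q × 0ℤ ℤ.< r

oriented? : ∀ p q r → Dec (Oriented p q r)
oriented? p q r = (0ℤ ℤₚ.<? p) ×-dec (0ℤ ℤₚ.<? q) ×-dec (0ℤ ℤₚ.<? r)

-- Equal strict signs mean a directed path through the vertex shared by the two edges. In the
-- `mixed` case the quiver is acyclic both before and after mutating at that vertex.
data Signs : ℤ → ℤ → Set where
  both+ : ∀ {b c} → Signs +[1+ b ] +[1+ c ]
  both- : ∀ {b c} → Signs -[1+ b ] -[1+ c ]
  mixed : ∀ {q r} → half q r ≡ 0ℤ → ¬ (0ℤ ℤ.< q × 0ℤ ℤ.< r) →
          ¬ (0ℤ ℤ.< - q × 0ℤ ℤ.< - r) → Signs q r

signs : ∀ q r → Signs q r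
signs +0       +0       = mixed refl (λ { (+<+ () , _) }) (λ { (+<+ () , _) })
signs +0       +[1+ c ] = mixed refl (λ { (+<+ () , _) }) (λ { (+<+ () , _) })
signs +0       -[1+ c ] = mixed refl (λ { (+<+ () , _) }) (λ { (+<+ () , _) })
signs +[1+ b ] +0       = mixed (ℤₚ.*-zeroʳ +[1+ b ]) (λ { (_ , +<+ ()) }) (λ { (() , _) })
signs +[1+ b ] +[1+ c ] = both+
signs +[1+ b ] -[1+ c ] = mixed refl (λ { (_ , ()) }) (λ { (() , _) })
signs -[1+ b ] +0       = mixed refl (λ { (() , _) }) (λ { (_ , +<+ ()) })
signs -[1+ b ] +[1+ c ] = mixed refl (λ { (() , _) }) (λ { (_ , ()) })
signs -[1+ b ] -[1+ c ] = both-

doubled≤ : ∀ m n → 1 ≤ n → m ≤ ∣ m ⊖ n ∣ → m + m ≤ n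
doubled≤ m n 1≤n le with ≤-<-connex n m
... | inj₁ n≤m = contradiction (subst (m ≤_) (cong ∣_∣ (ℤₚ.⊖-≥ n≤m)) le)
                               (<⇒≱ (∸-monoʳ-< 1≤n n≤m))
... | inj₂ m<n = subst (m + m ≤_) (m+[n∸m]≡n (<⇒≤ m<n))
                   (+-monoʳ-≤ m (subst (m ≤_) (ℤₚ.∣⊖∣-< m<n) le))

-- Skew-symmetry turns the factors around into the cyclic order i, j, k, so that all three vertices
-- follow the same rule: p becomes p - `half q r`.
mutated : ∀ (Q : Quiver 3) i j k →
          B Q i j ℤ.+ numerator (B Q i k) (B Q k j) /ℕ 2 ≡ B Q i j ℤ.- half (B Q j k) (B Q k i)
mutated Q i j k = cong (λ z → B Q i j ℤ.+ z)
  (trans (half-numerator-skew (B Q) (skew Q) i j k)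
         (cong -_ (numerator/2 (B Q j k) (B Q k i))))

oriented⇒cyclic : ∀ Q → Oriented (B Q 1F 2F) (B Q 2F 0F) (B Q 0F 1F) → Cyclic Q
oriented⇒cyclic Q (p , q , r) = 0F , 1F , 2F , r , p , q

antioriented⇒cyclic : ∀ Q → Oriented (- B Q 1F 2F) (- B Q 2F 0F) (- B Q 0F 1F) → Cyclic Q
antioriented⇒cyclic Q (p , q , r) = 0F , 2F , 1F , reverse q , reverse p , reverse r
  where
  reverse : ∀ {i j} → 0ℤ ℤ.< - B Q i j → Edge Q j i
  reverse {i} {j} = subst (0ℤ ℤ.<_) (sym (skew Q j i))

-- Trees of weight triples and their closure under mutation.

module Descent (E : ℕ → ℕ → ℕ → Set)
               (E-swap : ∀ {a b c} → E a b c → E b a c)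
               (E-rotate : ∀ {a b c} → E a b c → E b c a) where

  -- Weights of an oriented triangle that reaches its end by decreasing the largest weight:
  -- a leaf is one mutation away from an acyclic quiver with weights a, b, d.
  data Tree : ℕ → ℕ → ℕ → Set where
    leaf : ∀ {a b c d} → 1 ≤ a → 1 ≤ b → E a b d → c ≡ a * b + d → Tree a b c
    stuck : ∀ {a b c} → 1 ≤ a → 1 ≤ b → 1 ≤ c → Stuck a b c → Tree a b c
    grow : ∀ {a b c c′} → a ≤ c → b ≤ c → 1 ≤ c′ → c + c′ ≡ a * b →
           Tree a b c′ → Tree a b c
    swap : ∀ {a b c} → Tree a b c → Tree b a c
    rotate : ∀ {a b c} → Tree a b c → Tree b c a

  -- Mutating an oriented triangle at the vertex opposite to c replaces c by |a b − c|: the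
  -- result is again an oriented triangle if a b > c, and acyclic otherwise.
  MutatesAtThird : ℕ → ℕ → ℕ → Set
  MutatesAtThird a b c = (∀ c′ → 1 ≤ c′ → c + c′ ≡ a * b → Tree a b c′)
                       × (∀ d → c ≡ a * b + d → E a b d)

  MutatesEverywhere : ℕ → ℕ → ℕ → Set
  MutatesEverywhere a b c = MutatesAtThird a b c × MutatesAtThird b c a × MutatesAtThird c a b

  third-swap : ∀ {a b c} → MutatesAtThird a b c → MutatesAtThird b a c
  third-swap {a} {b} (f , g) =
    (λ c′ 1≤c′ e → swap (f c′ 1≤c′ (trans e (*-comm b a)))) ,
    (λ d e → E-swap (g d (trans e (cong (_+ d) (*-comm b a)))))

  -- From a + c ≤ 2c ≤ b c follows a′ = b c - a ≥ c, so `grow` applies over the given tree; 2a ≤ b c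
  -- excludes the acyclic outcome.
  mutate-smaller : ∀ {a b c} → 1 ≤ a → a ≤ c → 1 < b → b ≤ c →
                   Tree a b c → MutatesAtThird b c a
  mutate-smaller {a} {b} {c} 1≤a a≤c 1<b b≤c t =
    (λ a′ _ e →
      let c≤a′ = +-cancelˡ-≤ a c a′ (subst (a + c ≤_) (sym e) (≤-trans (+-monoˡ-≤ c a≤c) (double≤* 1<b)))
      in grow (≤-trans b≤c c≤a′) c≤a′ 1≤a (trans (+-comm a′ a) e) (rotate t)) ,
    (λ d e → contradiction e
      (no-overshoot 1≤a (≤-trans (+-mono-≤ a≤c a≤c) (double≤* 1<b))))

  -- For b = 1 the mutation decreases a although c is the largest weight; it then leads to
  -- another leaf over the same acyclic weights.
  mutate-leaf-smaller : ∀ {a b c d} → 1 ≤ a → 1 ≤ b → E a b d → c ≡ a * b + d →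
                        MutatesAtThird b c a
  mutate-leaf-smaller {a} {b} {c} {d} 1≤a 1≤b x refl with m≤n⇒m<n∨m≡n 1≤b
  ... | inj₁ 1<b = mutate-smaller 1≤a
          (≤-trans (≤-trans (≤-reflexive (sym (*-identityʳ a))) (*-monoʳ-≤ a 1≤b)) (m≤m+n _ d))
          1<b
          (≤-trans (≤-trans (≤-reflexive (sym (*-identityˡ b))) (*-monoˡ-≤ b 1≤a)) (m≤m+n _ d))
          (leaf 1≤a 1≤b x refl)
  ... | inj₂ refl rewrite *-identityʳ a =
    (λ a′ 1≤a′ e → via a′ 1≤a′ (+-cancelˡ-≡ a a′ d (trans e (+-identityʳ (a + d))))) ,
    λ d′ e → end d′ (trans e (cong (_+ d′) (+-identityʳ (a + d))))
    where
    via : ∀ a′ → 1 ≤ a′ → a′ ≡ d → Tree 1 (a + d) a′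
    -- The new weight is d, and c = a + d = 1 · d + a gives a leaf in which a and d have exchanged
    -- roles.
    via a′ 1≤a′ refl = rotate (swap (leaf ≤-refl 1≤a′ (E-rotate x)
      (trans (+-comm a d) (cong (_+ a) (sym (+-identityʳ d))))))
    end : ∀ d′ → a ≡ a + d + d′ → E 1 (a + d) d′
    -- a = a + d + d′ forces d = d′ = 0, so the acyclic weights are 1, a and 0 again.
    end d′ e with m+n≡0⇒m≡0 d s | m+n≡0⇒n≡0 d {d′} s
      where
      s : d + d′ ≡ 0
      s = sym (+-cancelˡ-≡ a 0 (d + d′) (trans (+-identityʳ a) (trans e (+-assoc a d d′))))
    ... | refl | refl = subst (λ z → E 1 z 0) (sym (+-identityʳ a)) (E-swap x)

  -- a ≤ c < c + c′ = a b forces b > 1, so `mutate-smaller` applies.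
  mutate-grown-smaller : ∀ {a b c c′} → 1 ≤ a → a ≤ c → b ≤ c → 1 ≤ c′ → c + c′ ≡ a * b →
                         Tree a b c → MutatesAtThird b c a
  mutate-grown-smaller {a} {b} {c} {c′} 1≤a a≤c b≤c 1≤c′ e =
    mutate-smaller 1≤a a≤c
      (*-cancelˡ-< a 1 b (subst₂ _<_ (sym (*-identityʳ a)) e
        (≤-<-trans a≤c (m<m+n c 1≤c′)))) b≤c

  -- By `+≤*` the new weight a b - c is at least a and at least b, so the result is grown over the
  -- stuck triple itself.
  mutate-stuck : ∀ {a b c} → 1 ≤ a → 1 ≤ b → 1 ≤ c → Stuck a b c → MutatesAtThird a b c
  mutate-stuck {a} {b} {c} 1≤a 1≤b 1≤c st@(p , q , r) =
    (λ c′ _ e → grow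
      (bound {a} e (+≤* {a} 1<b r))
      (bound {b} e (subst (b + c ≤_) (*-comm b a) (+≤* {b} 1<a (subst (c + c ≤_) (*-comm a b) r))))
      1≤c (trans (+-comm c′ c) e) (stuck 1≤a 1≤b 1≤c st)) ,
    (λ d e → contradiction e (no-overshoot 1≤c r))
    where
    1<b = stuck>1 1≤a 1≤c st
    1<a = stuck>1 1≤c 1≤b (r , p , q)
    bound : ∀ {m c′ n} → c + c′ ≡ n → m + c ≤ n → m ≤ c′
    bound {m} {c′} refl le = +-cancelˡ-≤ c m c′ (subst (_≤ c + c′) (+-comm m c) le)

  -- At `leaf` and `grow`, mutating the third weight undoes the constructor; the mutations of the
  -- first two weights are mirror images of each other.
  mutatesEverywhere : ∀ {a b c} → Tree a b c → MutatesEverywhere a b c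
  mutatesEverywhere (leaf {a} {b} {c} {d} 1≤a 1≤b x e) =
    ((λ c′ 1≤c′ e′ → contradiction
       (trans (trans (sym (+-assoc (a * b) d c′)) (cong (_+ c′) (sym e)))
              (trans e′ (sym (+-identityʳ (a * b)))))
       λ z → <-irrefl (sym (m+n≡0⇒n≡0 d (+-cancelˡ-≡ (a * b) (d + c′) 0 z))) 1≤c′) ,
     λ d′ e′ → subst (E a b) (+-cancelˡ-≡ (a * b) d d′ (trans (sym e) e′)) x) ,
    mutate-leaf-smaller 1≤a 1≤b x e ,
    third-swap (mutate-leaf-smaller 1≤b 1≤a (E-swap x) (trans e (cong (_+ d) (*-comm a b))))
  mutatesEverywhere (stuck 1≤a 1≤b 1≤c (p , q , r)) =
    mutate-stuck 1≤a 1≤b 1≤c (p , q , r) ,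
    mutate-stuck 1≤b 1≤c 1≤a (q , r , p) ,
    mutate-stuck 1≤c 1≤a 1≤b (r , p , q)
  mutatesEverywhere (grow {a} {b} {c} {c′} a≤c b≤c 1≤c′ e t) =
    ((λ c″ _ e″ → subst (Tree a b) (+-cancelˡ-≡ c c′ c″ (trans e (sym e″))) t) ,
     λ d e″ → contradiction (trans e″ (cong (_+ d) (sym e)))
       (λ z → <-irrefl z (<-≤-trans (m<m+n c 1≤c′) (m≤m+n (c + c′) d)))) ,
    mutate-grown-smaller (proj₁ ab>0) a≤c b≤c 1≤c′ e g ,
    third-swap (mutate-grown-smaller (proj₂ ab>0) b≤c a≤c 1≤c′ (trans e (*-comm a b)) (swap g))
    where
    g = grow a≤c b≤c 1≤c′ e t
    ab>0 = factorsPositive 1≤c′ (subst (c′ ≤_) e (m≤n+m c′ c))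
  mutatesEverywhere (swap t) = let x , y , z = mutatesEverywhere t in
    third-swap x , third-swap z , third-swap y
  mutatesEverywhere (rotate t) = let x , y , z = mutatesEverywhere t in y , z , x

  -- Confinement of signed triples and of quivers.

  -- Confined p q r implies that all acyclic quivers in the mutation class of (p , q , r)
  -- have weights in E; for E = ⊥ the quiver is cluster-cyclic.
  data Confined : ℤ → ℤ → ℤ → Set where
    acyclic : ∀ {p q r} → ¬ Oriented p q r → ¬ Oriented (- p) (- q) (- r) →
              E (∣ p ∣) (∣ q ∣) (∣ r ∣) → Confined p q r
    cycle+  : ∀ {a b c} → Tree (suc a) (suc b) (suc c) → Confined +[1+ a ] +[1+ b ] +[1+ c ]
    cycle-  : ∀ {a b c} → Tree (suc a) (suc b) (suc c) → Confined -[1+ a ] -[1+ b ] -[1+ c ]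

  confined-first : ∀ {p p′ q r} → p ≡ p′ → Confined p q r → Confined p′ q r
  confined-first refl t = t

  confined-rotate : ∀ {p q r} → Confined p q r → Confined q r p
  confined-rotate (acyclic ¬o ¬o′ x) =
    acyclic (λ (a , b , c) → ¬o (c , a , b)) (λ (a , b , c) → ¬o′ (c , a , b)) (E-rotate x)
  confined-rotate (cycle+ t) = cycle+ (rotate t)
  confined-rotate (cycle- t) = cycle- (rotate t)

  -- The edges b and c are reversed. If a < b c, the third edge turns too and the triangle reverses
  -- its orientation; otherwise that edge keeps its direction or vanishes, and the quiver is
  -- acyclic.
  mutate-cycle+ : ∀ {a b c} → Tree (suc a) (suc b) (suc c) →
                  Confined (suc a ⊖ (suc b * suc c)) -[1+ b ] -[1+ c ]
  mutate-cycle+ {a} {b} {c} t with mutatesEverywhere t | ≤-<-connex (suc b * suc c) (suc a)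
  ... | _ , (_ , ends) , _ | inj₁ bc≤a with m≤n⇒∃[o]m+o≡n bc≤a
  ... | d , e = confined-first
                  (sym (trans (cong (_⊖ (suc b * suc c)) (sym e)) ([m+n]⊖m≡n (suc b * suc c) d)))
                  (acyclic (λ { (_ , () , _) }) (-n≯0 d ∘ proj₁) (E-rotate (E-rotate (ends d (sym e)))))
  mutate-cycle+ {a} {b} {c} t | _ , (turns , _) , _ | inj₂ a<bc with m≤n⇒∃[o]m+o≡n a<bc
  ... | k , e = confined-first
                  (sym (trans (cong (suc a ⊖_) (sym e′)) (m⊖[m+n]≡-n (suc a) (suc k))))
                  (cycle- (rotate (rotate (turns (suc k) (s≤s z≤n) e′))))
    where e′ = trans (+-suc (suc a) k) e

  mutate-cycle- : ∀ {a b c} → Tree (suc a) (suc b) (suc c) →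
                  Confined ((suc b * suc c) ⊖ suc a) +[1+ b ] +[1+ c ]
  mutate-cycle- {a} {b} {c} t with mutatesEverywhere t | ≤-<-connex (suc b * suc c) (suc a)
  ... | _ , (_ , ends) , _ | inj₁ bc≤a with m≤n⇒∃[o]m+o≡n bc≤a
  ... | d , e = confined-first
                  (sym (trans (cong ((suc b * suc c) ⊖_) (sym e)) (m⊖[m+n]≡-n (suc b * suc c) d)))
                  (acyclic (-n≯0 d ∘ proj₁) (λ { (_ , () , _) })
                    (subst (λ z → E z _ _) (sym (ℤₚ.∣-i∣≡∣i∣ (+ d)))
                      (E-rotate (E-rotate (ends d (sym e))))))
  mutate-cycle- {a} {b} {c} t | _ , (turns , _) , _ | inj₂ a<bc with m≤n⇒∃[o]m+o≡n a<bc
  ... | k , e = confined-first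
                  (sym (trans (cong (_⊖ suc a) (sym e′)) ([m+n]⊖m≡n (suc a) (suc k))))
                  (cycle+ (rotate (rotate (turns (suc k) (s≤s z≤n) e′))))
    where e′ = trans (+-suc (suc a) k) e

  grown-leaf : ∀ {a b c m} → E a (suc b) (suc c) → m ≡ suc b * suc c + a → Tree m (suc b) (suc c)
  grown-leaf x e = rotate (rotate (leaf (s≤s z≤n) (s≤s z≤n) (E-rotate x) e))

  -- An acyclic triple becomes cyclic only if q and r have equal strict signs. Then p is zero or of
  -- the opposite sign, so nothing cancels in p - `half q r`: the new weight |p| + |q| |r| makes a
  -- leaf.
  confined-mutate : ∀ {p q r} → Confined p q r → Confined (p ℤ.- half q r) (- q) (- r)
  confined-mutate (cycle+ t) = mutate-cycle+ t
  confined-mutate (cycle- t) = mutate-cycle- t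
  confined-mutate {p} {q} {r} (acyclic ¬o ¬o′ x) with signs q r
  ... | mixed h≡0 ¬+ ¬- rewrite h≡0 | ℤₚ.+-identityʳ p =
    acyclic (λ (_ , s) → ¬- s)
            (λ (_ , s) → ¬+ (subst₂ (λ y z → 0ℤ ℤ.< y × 0ℤ ℤ.< z)
                               (ℤₚ.neg-involutive q) (ℤₚ.neg-involutive r) s))
            (subst₂ (E ∣ p ∣) (sym (ℤₚ.∣-i∣≡∣i∣ q)) (sym (ℤₚ.∣-i∣≡∣i∣ r)) x)
  confined-mutate {+0} (acyclic ¬o ¬o′ x) | both+ {b} {c} =
    cycle- (grown-leaf x (sym (+-identityʳ _)))
  confined-mutate {+[1+ a ]} (acyclic ¬o ¬o′ x) | both+ =
    contradiction (+<+ (s≤s z≤n) , +<+ (s≤s z≤n) , +<+ (s≤s z≤n)) ¬o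
  confined-mutate { -[1+ a ] } (acyclic ¬o ¬o′ x) | both+ {b} {c} =
    cycle- (grown-leaf x (cong suc (trans (cong suc (+-comm a _)) (sym (+-suc _ a)))))
  confined-mutate {+0} (acyclic ¬o ¬o′ x) | both- {b} {c} =
    cycle+ (grown-leaf x (sym (+-identityʳ _)))
  confined-mutate {+[1+ a ]} (acyclic ¬o ¬o′ x) | both- {b} {c} =
    cycle+ (grown-leaf x (+-comm (suc a) (suc b * suc c)))
  confined-mutate { -[1+ a ] } (acyclic ¬o ¬o′ x) | both- =
    contradiction (+<+ (s≤s z≤n) , +<+ (s≤s z≤n) , +<+ (s≤s z≤n)) ¬o′

  -- Mutation at a fixed vertex is an involution, because negating both arguments of `half` negates
  -- its value. For triples of entries this needs no equality of matrices as functions.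
  confined-unmutate : ∀ {p q r} → Confined (p ℤ.- half q r) (- q) (- r) → Confined p q r
  confined-unmutate {p} {q} {r} t =
    subst₂ (Confined p) (ℤₚ.neg-involutive q) (ℤₚ.neg-involutive r)
      (subst (λ z → Confined z (- - q) (- - r)) cancel (confined-mutate t))
    where
    open ≡-Reasoning
    h = half q r
    cancel : p ℤ.- h ℤ.- half (- q) (- r) ≡ p
    cancel = begin
      p ℤ.- h ℤ.- half (- q) (- r)  ≡⟨ cong (λ z → p ℤ.- h ℤ.- z) (half-neg q r) ⟩
      p ℤ.- h ℤ.- (- h)             ≡⟨ ℤₚ.+-assoc p (- h) (- - h) ⟩
      p ℤ.+ (- h ℤ.- (- h))         ≡⟨ cong (λ z → p ℤ.+ z) (ℤₚ.+-inverseʳ (- h)) ⟩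
      p ℤ.+ 0ℤ                      ≡⟨ ℤₚ.+-identityʳ p ⟩
      p                             ∎

  ConfinedQuiver : Quiver 3 → Set
  ConfinedQuiver Q = Confined (B Q 1F 2F) (B Q 2F 0F) (B Q 0F 1F)

  confined-mutateQuiver : ∀ Q k → ConfinedQuiver Q → ConfinedQuiver (mutate k Q)
  confined-mutateQuiver Q 0F t = confined-first (sym (mutated Q 1F 2F 0F))
    (confined-mutate t)
  confined-mutateQuiver Q 1F t = confined-rotate (confined-rotate
    (confined-first (sym (mutated Q 2F 0F 1F))
      (confined-mutate (confined-rotate t))))
  confined-mutateQuiver Q 2F t = confined-rotate
    (confined-first (sym (mutated Q 0F 1F 2F))
      (confined-mutate (confined-rotate (confined-rotate t))))

  confined-unmutateQuiver : ∀ Q k → ConfinedQuiver (mutate k Q) → ConfinedQuiver Q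
  confined-unmutateQuiver Q 0F t = confined-unmutate
    (confined-first (mutated Q 1F 2F 0F) t)
  confined-unmutateQuiver Q 1F t = confined-rotate (confined-rotate (confined-unmutate
    (confined-first (mutated Q 2F 0F 1F) (confined-rotate t))))
  confined-unmutateQuiver Q 2F t = confined-rotate (confined-unmutate
    (confined-first (mutated Q 0F 1F 2F) (confined-rotate (confined-rotate t))))

  confined-along : ∀ Q ks → ConfinedQuiver Q → ConfinedQuiver (mutateAlong ks Q)
  confined-along Q []       t = t
  confined-along Q (k ∷ ks) t = confined-along (mutate k Q) ks (confined-mutateQuiver Q k t)

  confined-back : ∀ Q ks → ConfinedQuiver (mutateAlong ks Q) → ConfinedQuiver Q
  confined-back Q []       t = t
  confined-back Q (k ∷ ks) t = confined-unmutateQuiver Q k (confined-back (mutate k Q) ks t)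

  acyclic-confined : ∀ Q → Acyclic Q → E (∣ B Q 1F 2F ∣) (∣ B Q 2F 0F ∣) (∣ B Q 0F 1F ∣) →
                     ConfinedQuiver Q
  acyclic-confined Q ac = acyclic (ac ∘ oriented⇒cyclic Q) (ac ∘ antioriented⇒cyclic Q)

  confined-cases : ∀ Q → ConfinedQuiver Q →
                   Cyclic Q ⊎ E (∣ B Q 1F 2F ∣) (∣ B Q 2F 0F ∣) (∣ B Q 0F 1F ∣)
  confined-cases Q t = go refl refl refl t
    where
    go : ∀ {p q r} → B Q 1F 2F ≡ p → B Q 2F 0F ≡ q → B Q 0F 1F ≡ r → Confined p q r →
         Cyclic Q ⊎ E (∣ p ∣) (∣ q ∣) (∣ r ∣)
    go ep eq er (acyclic _ _ x) = inj₂ x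
    go ep eq er (cycle+ _) = inj₁ (oriented⇒cyclic Q
      (subst (0ℤ ℤ.<_) (sym ep) (+<+ (s≤s z≤n)) , subst (0ℤ ℤ.<_) (sym eq) (+<+ (s≤s z≤n)) ,
       subst (0ℤ ℤ.<_) (sym er) (+<+ (s≤s z≤n))))
    go ep eq er (cycle- _) = inj₁ (antioriented⇒cyclic Q
      (subst (λ z → 0ℤ ℤ.< - z) (sym ep) (+<+ (s≤s z≤n)) ,
       subst (λ z → 0ℤ ℤ.< - z) (sym eq) (+<+ (s≤s z≤n)) ,
       subst (λ z → 0ℤ ℤ.< - z) (sym er) (+<+ (s≤s z≤n))))

  -- Valid for every E, as a `stuck` tree has no acyclic end.
  stuck-confined+ : ∀ p q r → Oriented p q r →
                    ∣ p ∣ ≤ ∣ p ℤ.- half q r ∣ → ∣ q ∣ ≤ ∣ q ℤ.- half r p ∣ →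
                    ∣ r ∣ ≤ ∣ r ℤ.- half p q ∣ → Confined p q r
  stuck-confined+ +[1+ a ] +[1+ b ] +[1+ c ] _ x y z =
    cycle+ (stuck (s≤s z≤n) (s≤s z≤n) (s≤s z≤n)
      (doubled≤ (suc a) (suc b * suc c) (s≤s z≤n) x ,
       doubled≤ (suc b) (suc c * suc a) (s≤s z≤n) y ,
       doubled≤ (suc c) (suc a * suc b) (s≤s z≤n) z))
  stuck-confined+ +0 _ _ (+<+ () , _)
  stuck-confined+ _ +0 _ (_ , +<+ () , _)
  stuck-confined+ _ _ +0 (_ , _ , +<+ ())

  stuck-confined- : ∀ p q r → Oriented (- p) (- q) (- r) →
                    ∣ p ∣ ≤ ∣ p ℤ.- half q r ∣ → ∣ q ∣ ≤ ∣ q ℤ.- half r p ∣ →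
                    ∣ r ∣ ≤ ∣ r ℤ.- half p q ∣ → Confined p q r
  stuck-confined- -[1+ a ] -[1+ b ] -[1+ c ] _ x y z =
    cycle- (stuck (s≤s z≤n) (s≤s z≤n) (s≤s z≤n)
      (bound (suc a) (suc b * suc c) (s≤s z≤n) x ,
       bound (suc b) (suc c * suc a) (s≤s z≤n) y ,
       bound (suc c) (suc a * suc b) (s≤s z≤n) z))
    where
    bound : ∀ m n → 1 ≤ n → m ≤ ∣ n ⊖ m ∣ → m + m ≤ n
    bound m n 1≤n le = doubled≤ m n 1≤n (subst (m ≤_) (ℤₚ.∣m⊖n∣≡∣n⊖m∣ n m) le)
  stuck-confined- +0 _ _ (+<+ () , _)
  stuck-confined- +[1+ _ ] _ _ (() , _)
  stuck-confined- -[1+ _ ] +0 _ (_ , +<+ () , _)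
  stuck-confined- -[1+ _ ] +[1+ _ ] _ (_ , () , _)
  stuck-confined- -[1+ _ ] -[1+ _ ] +0 (_ , _ , +<+ ())
  stuck-confined- -[1+ _ ] -[1+ _ ] +[1+ _ ] (_ , _ , ())

-- The cluster-cyclic alternative.

module NoAcyclicMember = Descent (λ _ _ _ → ⊥) (λ ()) (λ ())

ConfinedToCyclic : Quiver 3 → Set
ConfinedToCyclic = NoAcyclicMember.ConfinedQuiver

Acyclic-resp-≅ : ∀ P Q → P ≅ Q → Acyclic Q → Acyclic P
Acyclic-resp-≅ P Q (σ , eq) ac (i , j , k , x , y , z) =
  ac (_ , _ , _ , subst (0ℤ ℤ.<_) (eq i j) x , subst (0ℤ ℤ.<_) (eq j k) y ,
      subst (0ℤ ℤ.<_) (eq k i) z)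

clusterCyclic : ∀ S → ConfinedToCyclic S → ClusterCyclic S
clusterCyclic S t Q (ks , σ , eq)
  with NoAcyclicMember.confined-cases (mutateAlong ks S) (NoAcyclicMember.confined-along S ks t)
... | inj₁ (i , j , k , x , y , z) =
  _ , _ , _ , subst (0ℤ ℤ.<_) (eq i j) x , subst (0ℤ ℤ.<_) (eq j k) y ,
              subst (0ℤ ℤ.<_) (eq k i) z

-- Weights and isomorphism of underlying graphs.

weights : Quiver 3 → List ℕ
weights Q = ∣ B Q 1F 2F ∣ ∷ ∣ B Q 2F 0F ∣ ∷ ∣ B Q 0F 1F ∣ ∷ []

diagonal : ∀ {n} (Q : Quiver n) i → B Q i i ≡ 0ℤ
diagonal Q i with B Q i i | skew Q i i
... | +0       | _ = refl
... | +[1+ _ ] | ()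
... | -[1+ _ ] | ()

posPart : ℤ → ℕ
posPart x = ∣ 0ℤ ℤ.⊔ x ∣

posPart-split : ∀ x → posPart x + posPart (- x) ≡ ∣ x ∣
posPart-split +0       = refl
posPart-split +[1+ n ] = +-identityʳ (suc n)
posPart-split -[1+ n ] = refl

-- Opposite entries are x and -x, and their positive parts add up to |x|.
totalWeight≡ : ∀ Q → totalWeight Q ≡ sum (weights Q)
totalWeight≡ Q rewrite diagonal Q 0F | diagonal Q 1F | diagonal Q 2F
                     | skew Q 0F 2F | skew Q 1F 0F | skew Q 2F 1F
                     | sym (posPart-split (B Q 1F 2F)) | sym (posPart-split (B Q 2F 0F))
                     | sym (posPart-split (B Q 0F 1F)) =
  regroup (posPart (B Q 1F 2F)) (posPart (- B Q 1F 2F))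
          (posPart (B Q 2F 0F)) (posPart (- B Q 2F 0F))
          (posPart (B Q 0F 1F)) (posPart (- B Q 0F 1F))
  where
  regroup : ∀ a a′ b b′ c c′ → (c + (b′ + 0)) + ((c′ + (a + 0)) + ((b + (a′ + 0)) + 0)) ≡
                               (a + a′) + ((b + b′) + ((c + c′) + 0))
  regroup = solve-∀

totalWeight-resp-≅ : ∀ {n} (P Q : Quiver n) → P ≅ Q → totalWeight P ≡ totalWeight Q
totalWeight-resp-≅ P Q (σ , eq) = begin
  totalWeight P
    ≡⟨ sum-cong-≗ (λ i → sum-cong-≗ λ j → cong posPart (eq i j)) ⟩
  ∑ (λ i → ∑ λ j → posPart (B Q (σ ⟨$⟩ʳ i) (σ ⟨$⟩ʳ j)))
    ≡⟨ sum-cong-≗ (λ i → sum-permute (λ j → posPart (B Q (σ ⟨$⟩ʳ i) j)) σ) ⟨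
  ∑ (λ i → ∑ λ j → posPart (B Q (σ ⟨$⟩ʳ i) j))
    ≡⟨ sum-permute (λ i → ∑ λ j → posPart (B Q i j)) σ ⟨
  totalWeight Q  ∎
  where open ≡-Reasoning

-- c-arrangements follow the cyclic order 0, 1, 2, and a-arrangements reverse it.
data Arrangement : Fin 3 → Fin 3 → Fin 3 → Set where
  c012 : Arrangement 0F 1F 2F
  c120 : Arrangement 1F 2F 0F
  c201 : Arrangement 2F 0F 1F
  a021 : Arrangement 0F 2F 1F
  a210 : Arrangement 2F 1F 0F
  a102 : Arrangement 1F 0F 2F

arrangement : ∀ i j k → i ≢ j → j ≢ k → k ≢ i → Arrangement i j k
arrangement 0F 1F 2F _ _ _ = c012
arrangement 1F 2F 0F _ _ _ = c120
arrangement 2F 0F 1F _ _ _ = c201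
arrangement 0F 2F 1F _ _ _ = a021
arrangement 2F 1F 0F _ _ _ = a210
arrangement 1F 0F 2F _ _ _ = a102
arrangement 0F 0F _  i≢j _ _ = contradiction refl i≢j
arrangement 1F 1F _  i≢j _ _ = contradiction refl i≢j
arrangement 2F 2F _  i≢j _ _ = contradiction refl i≢j
arrangement _  0F 0F _ j≢k _ = contradiction refl j≢k
arrangement _  1F 1F _ j≢k _ = contradiction refl j≢k
arrangement _  2F 2F _ j≢k _ = contradiction refl j≢k
arrangement 0F _  0F _ _ k≢i = contradiction refl k≢i
arrangement 1F _  1F _ _ k≢i = contradiction refl k≢i
arrangement 2F _  2F _ _ k≢i = contradiction refl k≢i

Edge-irrefl : ∀ {n} (Q : Quiver n) {i j} → Edge Q i j → i ≢ j
Edge-irrefl Q {i} e refl = ℤₚ.<-irrefl (sym (diagonal Q i)) e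

Edge-neg : ∀ {n} (Q : Quiver n) {i j} → Edge Q i j → 0ℤ ℤ.< - B Q j i
Edge-neg Q {i} {j} = subst (0ℤ ℤ.<_) (skew Q i j)

cyclic⇒oriented : ∀ Q → Cyclic Q → Oriented (B Q 1F 2F) (B Q 2F 0F) (B Q 0F 1F)
                                 ⊎ Oriented (- B Q 1F 2F) (- B Q 2F 0F) (- B Q 0F 1F)
cyclic⇒oriented Q (i , j , k , x , y , z)
  with arrangement i j k (Edge-irrefl Q x) (Edge-irrefl Q y) (Edge-irrefl Q z)
... | c012 = inj₁ (y , z , x)
... | c120 = inj₁ (x , y , z)
... | c201 = inj₁ (z , x , y)
... | a021 = inj₂ (Edge-neg Q y , Edge-neg Q x , Edge-neg Q z)
... | a210 = inj₂ (Edge-neg Q x , Edge-neg Q z , Edge-neg Q y)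
... | a102 = inj₂ (Edge-neg Q z , Edge-neg Q y , Edge-neg Q x)

∣B∣≡opposite : ∀ Q {i j k} → Arrangement i j k → ∣ B Q i j ∣ ≡ lookup (weights Q) k
∣B∣≡opposite Q c012 = refl
∣B∣≡opposite Q c120 = refl
∣B∣≡opposite Q c201 = refl
∣B∣≡opposite Q a021 = trans (cong ∣_∣ (skew Q 0F 2F)) (ℤₚ.∣-i∣≡∣i∣ (B Q 2F 0F))
∣B∣≡opposite Q a210 = trans (cong ∣_∣ (skew Q 2F 1F)) (ℤₚ.∣-i∣≡∣i∣ (B Q 1F 2F))
∣B∣≡opposite Q a102 = trans (cong ∣_∣ (skew Q 1F 0F)) (ℤₚ.∣-i∣≡∣i∣ (B Q 0F 1F))

third : ∀ (i j : Fin 3) → i ≢ j → ∃[ k ] (j ≢ k × k ≢ i)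
third 0F 1F _ = 2F , (λ ()) , λ ()
third 0F 2F _ = 1F , (λ ()) , λ ()
third 1F 0F _ = 2F , (λ ()) , λ ()
third 1F 2F _ = 0F , (λ ()) , λ ()
third 2F 0F _ = 1F , (λ ()) , λ ()
third 2F 1F _ = 0F , (λ ()) , λ ()
third 0F 0F i≢i = contradiction refl i≢i
third 1F 1F i≢i = contradiction refl i≢i
third 2F 2F i≢i = contradiction refl i≢i

-- An edge of a triangle is determined by the opposite vertex, so a permutation of the three weights
-- is already a permutation of the vertices.
weights↭⇒≅ᵘ : ∀ P Q → weights P ↭ weights Q → P ≅ᵘ Q
weights↭⇒≅ᵘ P Q p = σ , entries
  where
  σ = onIndices (↭⇒↭ₛ p)
  injective : ∀ {i j} → i ≢ j → σ ⟨$⟩ʳ i ≢ σ ⟨$⟩ʳ j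
  injective i≢j e = i≢j (trans (sym (inverseˡ σ)) (trans (cong (σ ⟨$⟩ˡ_) e) (inverseˡ σ)))
  entries : ∀ i j → ∣ B P i j ∣ ≡ ∣ B Q (σ ⟨$⟩ʳ i) (σ ⟨$⟩ʳ j) ∣
  entries i j with i ≟ j
  ... | yes refl = cong ∣_∣ (trans (diagonal P i) (sym (diagonal Q (σ ⟨$⟩ʳ i))))
  ... | no i≢j = let k , j≢k , k≢i = third i j i≢j in begin
    ∣ B P i j ∣                        ≡⟨ ∣B∣≡opposite P (arrangement i j k i≢j j≢k k≢i) ⟩
    lookup (weights P) k               ≡⟨ onIndices-lookup (setoid ℕ) (↭⇒↭ₛ p) k ⟩
    lookup (weights Q) (σ ⟨$⟩ʳ k)      ≡⟨ ∣B∣≡opposite Q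
      (arrangement _ _ _ (injective i≢j) (injective j≢k) (injective k≢i)) ⟨
    ∣ B Q (σ ⟨$⟩ʳ i) (σ ⟨$⟩ʳ j) ∣      ∎
    where open ≡-Reasoning

≅⇒≅ᵘ : ∀ {n} (P Q : Quiver n) → P ≅ Q → P ≅ᵘ Q
≅⇒≅ᵘ P Q (σ , eq) = σ , λ i j → cong ∣_∣ (eq i j)

≅ᵘ-trans : ∀ {n} (P Q R : Quiver n) → P ≅ᵘ Q → Q ≅ᵘ R → P ≅ᵘ R
≅ᵘ-trans P Q R (σ , e) (τ , f) = σ ∘ₚ τ , λ i j → trans (e i j) (f (σ ⟨$⟩ʳ i) (σ ⟨$⟩ʳ j))

≅ᵘ-sym : ∀ {n} (P Q : Quiver n) → P ≅ᵘ Q → Q ≅ᵘ P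
≅ᵘ-sym P Q (σ , e) = flip σ , λ i j → sym (trans (e _ _)
  (cong₂ (λ x y → ∣ B Q x y ∣) (inverseʳ σ) (inverseʳ σ)))

-- Descent of the total weight.

weights-mutate : ∀ Q k → ¬ Decreases Q k → sum (weights Q) ≤ sum (weights (mutate k Q))
weights-mutate Q k ¬d = subst₂ _≤_ (totalWeight≡ Q) (totalWeight≡ (mutate k Q)) (≮⇒≥ ¬d)

-- The two edges at the mutated vertex keep their weights, so their terms cancel and only the
-- opposite edge is compared.
grows₀ : ∀ Q → ¬ Decreases Q 0F → ∣ B Q 1F 2F ∣ ≤ ∣ B Q 1F 2F ℤ.- half (B Q 2F 0F) (B Q 0F 1F) ∣
grows₀ Q ¬d with weights-mutate Q 0F ¬d
... | le rewrite mutated Q 1F 2F 0F | ℤₚ.∣-i∣≡∣i∣ (B Q 2F 0F) | ℤₚ.∣-i∣≡∣i∣ (B Q 0F 1F) =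
  +-cancelʳ-≤ _ _ _ le

grows₁ : ∀ Q → ¬ Decreases Q 1F → ∣ B Q 2F 0F ∣ ≤ ∣ B Q 2F 0F ℤ.- half (B Q 0F 1F) (B Q 1F 2F) ∣
grows₁ Q ¬d with weights-mutate Q 1F ¬d
... | le rewrite mutated Q 2F 0F 1F | ℤₚ.∣-i∣≡∣i∣ (B Q 1F 2F) | ℤₚ.∣-i∣≡∣i∣ (B Q 0F 1F) =
  +-cancelʳ-≤ _ _ _ (+-cancelˡ-≤ (∣ B Q 1F 2F ∣) _ _ le)

grows₂ : ∀ Q → ¬ Decreases Q 2F → ∣ B Q 0F 1F ∣ ≤ ∣ B Q 0F 1F ℤ.- half (B Q 1F 2F) (B Q 2F 0F) ∣
grows₂ Q ¬d with weights-mutate Q 2F ¬d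
... | le rewrite mutated Q 0F 1F 2F | ℤₚ.∣-i∣≡∣i∣ (B Q 1F 2F) | ℤₚ.∣-i∣≡∣i∣ (B Q 2F 0F) =
  +-cancelʳ-≤ _ _ _ (+-cancelˡ-≤ (∣ B Q 2F 0F ∣) _ _ (+-cancelˡ-≤ (∣ B Q 1F 2F ∣) _ _ le))

-- In an oriented triangle the three growth bounds yield a `stuck` tree, which is confined even for
-- empty E.
terminal : ∀ Q → (∀ k → ¬ Decreases Q k) → Acyclic Q ⊎ ConfinedToCyclic Q
terminal Q ¬d with oriented? p q r | oriented? (- p) (- q) (- r)
  where p = B Q 1F 2F ; q = B Q 2F 0F ; r = B Q 0F 1F
... | yes o | _      = inj₂ (NoAcyclicMember.stuck-confined+ _ _ _ o
    (grows₀ Q (¬d 0F)) (grows₁ Q (¬d 1F)) (grows₂ Q (¬d 2F)))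
... | no _  | yes o  = inj₂ (NoAcyclicMember.stuck-confined- _ _ _ o
    (grows₀ Q (¬d 0F)) (grows₁ Q (¬d 1F)) (grows₂ Q (¬d 2F)))
... | no ¬o | no ¬o′ = inj₁ ([ ¬o , ¬o′ ]′ ∘ cyclic⇒oriented Q)

-- Induction on the total weight; confinement at a stuck end is pulled back to Q by undoing the
-- mutations.
descend : ∀ Q → (∃[ ks ] (Acyclic (mutateAlong ks Q) × totalWeight (mutateAlong ks Q) ≤ totalWeight Q))
              ⊎ ConfinedToCyclic Q
descend Q = go Q (<-wellFounded _)
  where
  go : ∀ Q → Acc _<_ (totalWeight Q) →
       (∃[ ks ] (Acyclic (mutateAlong ks Q) × totalWeight (mutateAlong ks Q) ≤ totalWeight Q))
       ⊎ ConfinedToCyclic Q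
  go Q (acc rs) with any? (λ k → totalWeight (mutate k Q) <? totalWeight Q)
  ... | no ¬d with terminal Q (λ k d → ¬d (k , d))
  ...   | inj₁ ac = inj₁ ([] , ac , ≤-refl)
  ...   | inj₂ cc = inj₂ cc
  go Q (acc rs) | yes (k , d) with go (mutate k Q) (rs d)
  ...   | inj₁ (ks , ac , le) = inj₁ (k ∷ ks , ac , ≤-trans le (<⇒≤ d))
  ...   | inj₂ cc = inj₂ (NoAcyclicMember.confined-unmutateQuiver Q k cc)

-- Confinement to the weights reached by `ks` holds at that quiver by reflexivity; it is carried
-- back to S and then forward along `ls`.
acyclic-weights : ∀ S ks ls → Acyclic (mutateAlong ks S) → Acyclic (mutateAlong ls S) →
                  weights (mutateAlong ks S) ↭ weights (mutateAlong ls S)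
acyclic-weights S ks ls acR acP
  with confined-cases (mutateAlong ls S)
         (confined-along S ls (confined-back S ks (acyclic-confined (mutateAlong ks S) acR ↭-refl)))
  where
  open Descent (λ a b c → weights (mutateAlong ks S) ↭ a ∷ b ∷ c ∷ [])
    (λ x → ↭-trans x (Perm.swap _ _ ↭-refl))
    (λ x → ↭-trans x (↭-trans (Perm.swap _ _ ↭-refl) (Perm.prep _ (Perm.swap _ _ ↭-refl))))
... | inj₁ c = contradiction c acP
... | inj₂ p = p

-- Uniqueness, minimality and descent to the acyclic quiver.

theorem9p1 : (S : Quiver 3) → Connected S → ClusterAcyclic S →
    ∃! _≅ᵘ_ (λ S₀ → S₀ ∈MutationClass S × Acyclic S₀)
    × (∀ S₀ → S₀ ∈MutationClass S → Acyclic S₀ →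
    ∀ Q → Q ∈MutationClass S → totalWeight S₀ ≤ totalWeight Q)
    × (∀ S₀ → S₀ ∈MutationClass S → Acyclic S₀ →
    ∀ ks → MaximalDecreasingSequence S ks →
    Acyclic (mutateAlong ks S) × S₀ ≅ᵘ mutateAlong ks S)
theorem9p1 S _ ¬cc = existsUnique , minimal , maximal
  where
  same : ∀ P Q ((ks , _) : P ∈MutationClass S) ((ls , _) : Q ∈MutationClass S) →
         Acyclic P → Acyclic Q → weights (mutateAlong ks S) ↭ weights (mutateAlong ls S)
  same P Q (ks , p) (ls , q) acP acQ =
    acyclic-weights S ks ls (Acyclic-resp-≅ (mutateAlong ks S) P p acP)
                            (Acyclic-resp-≅ (mutateAlong ls S) Q q acQ)

  unique : ∀ P Q → P ∈MutationClass S → Q ∈MutationClass S → Acyclic P → Acyclic Q → P ≅ᵘ Q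
  unique P Q P∈@(ks , p) Q∈@(ls , q) acP acQ =
    ≅ᵘ-trans P P′ Q (≅ᵘ-sym P′ P (≅⇒≅ᵘ P′ P p))
      (≅ᵘ-trans P′ Q′ Q (weights↭⇒≅ᵘ P′ Q′ (same P Q P∈ Q∈ acP acQ)) (≅⇒≅ᵘ Q′ Q q))
    where
    P′ = mutateAlong ks S
    Q′ = mutateAlong ls S

  member : ∀ ks → mutateAlong ks S ∈MutationClass S
  member ks = ks , Permutation.id , λ _ _ → refl

  notCyclic : ∀ ks → ¬ ConfinedToCyclic (mutateAlong ks S)
  -- Confinement with empty E, carried back to S, makes the whole class cyclic.
  notCyclic ks t = ¬cc (clusterCyclic S (NoAcyclicMember.confined-back S ks t))

  existsUnique : ∃! _≅ᵘ_ (λ S₀ → S₀ ∈MutationClass S × Acyclic S₀)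
  existsUnique with descend S
  ... | inj₁ (ks , ac , _) =
    mutateAlong ks S , (member ks , ac) , λ {Q} (Q∈ , acQ) → unique (mutateAlong ks S) Q (member ks) Q∈ ac acQ
  ... | inj₂ cc = contradiction cc (notCyclic [])

  minimal : ∀ S₀ → S₀ ∈MutationClass S → Acyclic S₀ →
            ∀ Q → Q ∈MutationClass S → totalWeight S₀ ≤ totalWeight Q
  -- Descent from the representative of Q reaches an acyclic member that is no heavier, and by
  -- `same` it has the weights of S₀.
  minimal S₀ S₀∈@(ks , p) ac Q (ls , q) with descend (mutateAlong ls S)
  ... | inj₂ cc = contradiction cc (notCyclic ls)
  ... | inj₁ (ms , acR , le) = begin
    totalWeight S₀                                    ≡⟨ totalWeight-resp-≅ (mutateAlong ks S) S₀ p ⟨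
    totalWeight (mutateAlong ks S)                    ≡⟨ totalWeight≡ (mutateAlong ks S) ⟩
    sum (weights (mutateAlong ks S))                  ≡⟨ sum-↭ sameWeights ⟩
    sum (weights (mutateAlong (ls ++ ms) S))          ≡⟨ totalWeight≡ (mutateAlong (ls ++ ms) S) ⟨
    totalWeight (mutateAlong (ls ++ ms) S)            ≡⟨ cong totalWeight split ⟩
    totalWeight (mutateAlong ms (mutateAlong ls S))   ≤⟨ le ⟩
    totalWeight (mutateAlong ls S)                    ≡⟨ totalWeight-resp-≅ (mutateAlong ls S) Q q ⟩
    totalWeight Q                                     ∎
    where
    open ≤-Reasoning
    split : mutateAlong (ls ++ ms) S ≡ mutateAlong ms (mutateAlong ls S)
    split = foldl-++ (λ Q′ k → mutate k Q′) S ls ms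
    sameWeights : weights (mutateAlong ks S) ↭ weights (mutateAlong (ls ++ ms) S)
    sameWeights = same S₀ (mutateAlong (ls ++ ms) S) S₀∈ (member (ls ++ ms)) ac
      (subst Acyclic (sym split) acR)

  maximal : ∀ S₀ → S₀ ∈MutationClass S → Acyclic S₀ → ∀ ks → MaximalDecreasingSequence S ks →
            Acyclic (mutateAlong ks S) × S₀ ≅ᵘ mutateAlong ks S
  -- A sequence that cannot be prolonged ends in an acyclic quiver or a stuck triangle; the latter
  -- would make S cluster-cyclic.
  maximal S₀ S₀∈ ac ks (_ , ¬d) with terminal (mutateAlong ks S) ¬d
  ... | inj₁ acR = acR , unique S₀ (mutateAlong ks S) S₀∈ (member ks) ac acR
  ... | inj₂ cc  = contradiction cc (notCyclic ks)
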